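{- Let $\mathcal R$ and $\mathcal S$ be TRSs which are equivalent modulo $\mathcal B$ (i.e. $\leftrightarrow^*_{\mathcal R\cup\mathcal B}=\leftrightarrow^*_{\mathcal S\cup\mathcal B}$) and canonical modulo $\mathcal B$. If there is a $\mathcal B$-compatible reduction order $>$ with $\ell>r$ for all rules $\ell\to r\in\mathcal R\cup\mathcal S$, then every rule of $\mathcal R$ has a right-$\mathcal B$-equivalent variant in $\mathcal S$ and vice versa.
   Context: Terms over a signature $\mathcal F$; $\to_{\mathcal R}$ is the usual rewrite relation, $\leftarrow$ its inverse. $\mathcal B$ is a fixed ES with $\mathrm{Var}(\ell)=\mathrm{Var}(r)$ for all $\ell\approx r\in\mathcal B$, $\sim_{\mathcal B}=\leftrightarrow^*_{\mathcal B}$, $\to_{\mathcal R/\mathcal B}=\sim_{\mathcal B}\cdot\to_{\mathcal R}\cdot\sim_{\mathcal B}$. Terminating modulo $\mathcal B$: no infinite $\to_{\mathcal R/\mathcal B}$-sequence; Church–Rosser modulo $\mathcal B$: $\leftrightarrow^*_{\mathcal R\cup\mathcal B}\subseteq\to^*_{\mathcal R}\cdot\sim_{\mathcal B}\cdot\leftarrow^*_{\mathcal R}$; complete modulo $\mathcal B$: both. A TRS is left-reduced if for every rule $\ell\to r$, $\ell$ is a normal form of the TRS without that rule; right-$\mathcal B$-reduced if for every rule $\ell\to r$, $r$ is a normal form of $\to_{\mathcal R/\mathcal B}$; canonical modulo $\mathcal B$ if complete modulo $\mathcal B$, left-reduced and right-$\mathcal B$-reduced. A $\mathcal B$-compatible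 reduction order is a well-founded order on terms closed under contexts and substitutions with $\sim_{\mathcal B}\cdot>\cdot\sim_{\mathcal B}\subseteq>$. Two rules $\ell\to r,\ell'\to r'$ are right-$\mathcal B$-equivalent variants if there is a renaming $\sigma$ with $\ell\sigma=\ell'$ and $r\sigma\sim_{\mathcal B}r'$. -}

module Defs where

open import Data.Fin using (Fin)
open import Data.Nat using (ℕ)
open import Data.Product using (∃-syntax; _×_; _,_)
open import Data.Vec using (Vec; []; _∷_; lookup; _[_]≔_)
open import Function using (_∘_; flip)
open import Function.Bundles using (_⇔_; _⤖_; module Bijection)
open import Induction.InfiniteDescent using (InfiniteDescendingSequence)
open import Level using (0ℓ)
open import Relation.Binary.Core using (Rel; _⇒_) renaming (_⇔_ to _≐_)
open import Relation.Binary.Construct.Closure.Equivalence using (EqClosure)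
open import Relation.Binary.Construct.Closure.ReflexiveTransitive using (Star)
-- the library operator is spelled with U+037E (Greek question mark), not ASCII `;`
open import Relation.Binary.Construct.Composition using () renaming (_;_ to _⨾_)
open import Relation.Binary.Construct.Union using (_∪_)
open import Relation.Binary.PropositionalEquality using (_≡_; _≢_)
open import Relation.Binary.Rewriting using (IsNormalForm)
open import Relation.Binary.Structures using (IsStrictPartialOrder)
open import Relation.Nullary using (¬_)

record Signature : Set₁ where
  field
    Symbol : Set
    arity  : Symbol → ℕ

open Signature public

Var : Set
Var = ℕ

data Term (F : Signature) : Set where
  var : Var → Term F
  fun : (f : Symbol F) → Vec (Term F) (arity F f) → Term F

data _∈Var_ {F : Signature} (x : Var) : Term F → Set where
  here  : x ∈Var var x
  there : ∀ {f ts} (i : Fin (arity F f)) → x ∈Var lookup ts i → x ∈Var fun f ts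

Subst : Signature → Set
Subst F = Var → Term F

infixl 8 _·_ _·*_

mutual
  _·_ : ∀ {F} → Term F → Subst F → Term F
  var x    · σ = σ x
  fun f ts · σ = fun f (ts ·* σ)

  _·*_ : ∀ {F n} → Vec (Term F) n → Subst F → Vec (Term F) n
  []       ·* σ = []
  (t ∷ ts) ·* σ = t · σ ∷ ts ·* σ

-- In `arg f ts i C` the i-th entry of ts is a dummy: it is overwritten by
-- whatever is plugged into C.
data Context (F : Signature) : Set where
  □   : Context F
  arg : (f : Symbol F) → Vec (Term F) (arity F f) → Fin (arity F f) → Context F → Context F

_⟦_⟧ : ∀ {F} → Context F → Term F → Term F
□            ⟦ t ⟧ = t
arg f ts i C ⟦ t ⟧ = fun f (ts [ i ]≔ C ⟦ t ⟧)

-- An equational system is an arbitrary, possibly infinite, set of pairs of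
-- terms; `E ℓ r` says that ℓ ≈ r (or ℓ → r, for a TRS) belongs to E.
ES : Signature → Set₁
ES F = Rel (Term F) 0ℓ

module _ {F : Signature} where

  record IsTRS (R : ES F) : Set where
    field
      lhs-not-var : ∀ {ℓ r} → R ℓ r → ∀ x → ℓ ≢ var x
      rhs-vars    : ∀ {ℓ r} → R ℓ r → ∀ x → x ∈Var r → x ∈Var ℓ

  SameVars : ES F → Set
  SameVars B = ∀ {ℓ r} → B ℓ r → ∀ x → x ∈Var ℓ ⇔ x ∈Var r

  record Step (R : ES F) (s t : Term F) : Set where
    constructor step
    field
      {lhs rhs} : Term F
      rule      : R lhs rhs
      context   : Context F
      subst     : Subst F
      source    : s ≡ context ⟦ lhs · subst ⟧
      target    : t ≡ context ⟦ rhs · subst ⟧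

  Steps : ES F → Rel (Term F) 0ℓ
  Steps R = Star (Step R)

  Conv : ES F → Rel (Term F) 0ℓ
  Conv E = EqClosure (Step E)

  StepMod : ES F → ES F → Rel (Term F) 0ℓ
  StepMod B R = Conv B ⨾ Step R ⨾ Conv B

  TerminatingMod : ES F → ES F → Set
  TerminatingMod B R = ¬ (∃[ f ] InfiniteDescendingSequence (flip (StepMod B R)) f)

  ChurchRosserMod : ES F → ES F → Set
  ChurchRosserMod B R = Conv (R ∪ B) ⇒ (Steps R ⨾ Conv B ⨾ flip (Steps R))

  record CompleteMod (B R : ES F) : Set where
    field
      terminating  : TerminatingMod B R
      churchRosser : ChurchRosserMod B R

  _∖⟨_,_⟩ : ES F → Term F → Term F → ES F
  (R ∖⟨ ℓ , r ⟩) ℓ′ r′ = R ℓ′ r′ × (ℓ′ , r′) ≢ (ℓ , r)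

  LeftReduced : ES F → Set
  LeftReduced R = ∀ {ℓ r} → R ℓ r → IsNormalForm (Step (R ∖⟨ ℓ , r ⟩)) ℓ

  RightReducedMod : ES F → ES F → Set
  RightReducedMod B R = ∀ {ℓ r} → R ℓ r → IsNormalForm (StepMod B R) r

  record CanonicalMod (B R : ES F) : Set where
    field
      complete     : CompleteMod B R
      leftReduced  : LeftReduced R
      rightReduced : RightReducedMod B R

  EquivalentMod : ES F → ES F → ES F → Set
  EquivalentMod B R S = Conv (R ∪ B) ≐ Conv (S ∪ B)

  -- Well-foundedness is the absence of infinite descending sequences, which
  -- constructively is implied by accessibility of every term.
  record IsCompatibleReductionOrder (B : ES F) (_>_ : Rel (Term F) 0ℓ) : Set where
    field
      isStrictPartialOrder : IsStrictPartialOrder _≡_ _>_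
      wellFounded          : ¬ (∃[ f ] InfiniteDescendingSequence (flip _>_) f)
      context-closed       : ∀ {s t} (C : Context F) → s > t → (C ⟦ s ⟧) > (C ⟦ t ⟧)
      subst-closed         : ∀ {s t} (σ : Subst F) → s > t → (s · σ) > (t · σ)
      compatible           : (Conv B ⨾ _>_ ⨾ Conv B) ⇒ _>_

  Renaming : Set
  Renaming = Var ⤖ Var

  ⌊_⌋ : Renaming → Subst F
  ⌊ ρ ⌋ = var ∘ Bijection.to ρ

  RightEquivalentVariants : ES F → (ℓ r ℓ′ r′ : Term F) → Set
  RightEquivalentVariants B ℓ r ℓ′ r′ =
    ∃[ ρ ] (ℓ · ⌊ ρ ⌋ ≡ ℓ′ × Conv B (r · ⌊ ρ ⌋) r′)

  EveryRuleHasVariantIn : (B R S : ES F) → Set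
  EveryRuleHasVariantIn B R S =
    ∀ {ℓ r} → R ℓ r → ∃[ ℓ′ ] ∃[ r′ ] (S ℓ′ r′ × RightEquivalentVariants B ℓ r ℓ′ r′)

{-# OPTIONS --safe #-}
-- Right-hand sides of R are S-normal, since an S-descendant r′ < r would have
-- to rewrite back to r with R.  Hence a left-hand side ℓ of R is S-reducible,
-- ℓ = C[ℓ′σ], and in turn ℓ′ = C′[ℓ″τ] for a rule ℓ″ → r″ of R.  As R is
-- left-reduced, that rule is ℓ → r itself, so both contexts are empty and σ, τ
-- are mutually inverse on variables; hence ℓ and ℓ′ are variants.  Finally the
-- correspondingly renamed r and r′ are R-normal and convertible, so equal
-- modulo B.
--
-- Equality of function symbols is not assumed decidable, so left-reducedness
-- only yields ¬ ¬ (ℓ″ ≡ ℓ).  This is enough: comparing sizes shows that the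
-- contexts are empty, and "τσ fixes the variables of ℓ″" is decidable.
module Submission where

open import Defs
open import Data.Empty using (⊥-elim)
open import Data.Fin using (zero; suc)
open import Data.List using (List; []; _∷_; [_]; _++_)
open import Data.List.Relation.Unary.All as All using (All; []; _∷_)
open import Data.List.Relation.Unary.All.Properties using (++⁺; ++⁻ˡ; ++⁻ʳ)
open import Data.Nat using (ℕ; suc; _+_; _≤_; _≟_; _≤?_; z≤n; s≤s)
open import Data.Nat.Properties using (≤-refl; ≤-trans; <-irrefl; +-mono-≤; m≤n⇒m≤1+n; m≤m+n; m≤n+m; module ≤-Reasoning)
open import Data.Product using (_×_; _,_; proj₁; ∃; ∃-syntax)
open import Data.Sum using (inj₁; inj₂)
open import Data.Vec using (Vec; []; _∷_; _[_]≔_)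
open import Data.Vec.Properties using (∷-injective)
open import Function using (_∘_)
open import Function.Bundles using (_⤖_; mk↔ₛ′; module Bijection; module Inverse)
open import Function.Construct.Composition using (_⤖-∘_)
open import Function.Construct.Identity using (⤖-id)
open import Function.Properties.Bijection using (⤖⇒↔)
open import Function.Properties.Inverse using (↔⇒⤖)
open import Relation.Binary.Core using (Rel; _⇒_)
open import Relation.Binary.Construct.Closure.Equivalence using (symmetric; return)
open import Relation.Binary.Construct.Closure.ReflexiveTransitive using (ε; _◅_; _◅◅_)
open import Relation.Binary.Construct.Union using (_∪_)
open import Relation.Binary.PropositionalEquality using (_≡_; _≢_; refl; sym; trans; cong; cong₂; subst; subst₂; module ≡-Reasoning)
open import Relation.Binary.Rewriting using (IsNormalForm)
open import Relation.Binary.Structures using (IsStrictPartialOrder)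
open import Relation.Nullary using (¬_; Dec; yes; no)
open import Relation.Nullary.Decidable using (decidable-stable; map′)

-- Extending finite injections to renamings

transpose : ℕ → ℕ → ℕ → ℕ
transpose a b x with x ≟ a | x ≟ b
... | yes _ | _     = b
... | no _  | yes _ = a
... | no _  | no _  = x

transpose-eqˡ : ∀ a b → transpose a b a ≡ b
transpose-eqˡ a b with a ≟ a
... | yes _  = refl
... | no a≢a = ⊥-elim (a≢a refl)

transpose-eqʳ : ∀ a b → transpose a b b ≡ a
transpose-eqʳ a b with b ≟ a | b ≟ b
... | yes b≡a | _      = b≡a
... | no _    | yes _  = refl
... | no _    | no b≢b = ⊥-elim (b≢b refl)

transpose-neq : ∀ {a b x} → x ≢ a → x ≢ b → transpose a b x ≡ x
transpose-neq {a} {b} {x} x≢a x≢b with x ≟ a | x ≟ b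
... | yes x≡a | _       = ⊥-elim (x≢a x≡a)
... | no _    | yes x≡b = ⊥-elim (x≢b x≡b)
... | no _    | no _    = refl

transpose-involutive : ∀ a b x → transpose a b (transpose a b x) ≡ x
transpose-involutive a b x with x ≟ a | x ≟ b
... | yes x≡a | _       = trans (transpose-eqʳ a b) (sym x≡a)
... | no _    | yes x≡b = trans (transpose-eqˡ a b) (sym x≡b)
... | no x≢a  | no x≢b  = transpose-neq x≢a x≢b

transposition : ℕ → ℕ → ℕ ⤖ ℕ
transposition a b = ↔⇒⤖ (mk↔ₛ′ (transpose a b) (transpose a b)
  (transpose-involutive a b) (transpose-involutive a b))

-- Induction on the list: if the `ρ` built for the tail misses `f x`, follow it by the swap of `ρ x`
-- and `f x`. The swap fixes `f y` for each `y` in the tail: `ρ` is injective, `f` is injective on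
-- the list because `g` inverts it there, and a repeated `x` would already have been sent to `f x`.
extendToBijection : (f g : ℕ → ℕ) (xs : List ℕ) → All (λ x → g (f x) ≡ x) xs →
  ∃ λ (ρ : ℕ ⤖ ℕ) → All (λ x → Bijection.to ρ x ≡ f x) xs
extendToBijection f g []       []           = ⤖-id ℕ , []
extendToBijection f g (x ∷ xs) (gfx ∷ gfxs) with extendToBijection f g xs gfxs
... | ρ , ρ≗f with Bijection.to ρ x ≟ f x
...   | yes ρx≡fx = ρ , ρx≡fx ∷ ρ≗f
...   | no  ρx≢fx = transposition (Bijection.to ρ x) (f x) ⤖-∘ ρ
                  , transpose-eqˡ (Bijection.to ρ x) (f x) ∷ All.zipWith keep (ρ≗f , gfxs)
  where
  keep : ∀ {y} → Bijection.to ρ y ≡ f y × g (f y) ≡ y →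
         transpose (Bijection.to ρ x) (f x) (Bijection.to ρ y) ≡ f y
  keep {y} (ρy≡fy , gfy) = trans (transpose-neq
      (λ ρy≡ρx → y≢x (Bijection.injective ρ ρy≡ρx))
      (λ ρy≡fx → y≢x (trans (sym gfy) (trans (cong g (trans (sym ρy≡fy) ρy≡fx)) gfx))))
    ρy≡fy
    where
    y≢x : y ≢ x
    y≢x refl = ρx≢fx ρy≡fy

module _ {F : Signature} where

  -- Substitutions

  infixl 8 _⊙_

  _⊙_ : Subst F → Subst F → Subst F
  (σ ⊙ τ) x = σ x · τ

  mutual
    ·-⊙ : ∀ (t : Term F) σ τ → t · σ · τ ≡ t · (σ ⊙ τ)
    ·-⊙ (var x)    σ τ = refl
    ·-⊙ (fun f ts) σ τ = cong (fun f) (·*-⊙ ts σ τ)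

    ·*-⊙ : ∀ {n} (ts : Vec (Term F) n) σ τ → ts ·* σ ·* τ ≡ ts ·* (σ ⊙ τ)
    ·*-⊙ []       σ τ = refl
    ·*-⊙ (t ∷ ts) σ τ = cong₂ _∷_ (·-⊙ t σ τ) (·*-⊙ ts σ τ)

  mutual
    ·-identity : ∀ (t : Term F) σ → (∀ x → σ x ≡ var x) → t · σ ≡ t
    ·-identity (var x)    σ σ≗var = σ≗var x
    ·-identity (fun f ts) σ σ≗var = cong (fun f) (·*-identity ts σ σ≗var)

    ·*-identity : ∀ {n} (ts : Vec (Term F) n) σ → (∀ x → σ x ≡ var x) → ts ·* σ ≡ ts
    ·*-identity []       σ σ≗var = refl
    ·*-identity (t ∷ ts) σ σ≗var = cong₂ _∷_ (·-identity t σ σ≗var) (·*-identity ts σ σ≗var)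

  mutual
    vars : Term F → List Var
    vars (var x)    = [ x ]
    vars (fun f ts) = vars* ts

    vars* : ∀ {n} → Vec (Term F) n → List Var
    vars* []       = []
    vars* (t ∷ ts) = vars t ++ vars* ts

  mutual
    ·-cong : ∀ (t : Term F) {σ τ} → All (λ x → σ x ≡ τ x) (vars t) → t · σ ≡ t · τ
    ·-cong (var x)    (σx≡τx ∷ []) = σx≡τx
    ·-cong (fun f ts) σ≗τ          = cong (fun f) (·*-cong ts σ≗τ)

    ·*-cong : ∀ {n} (ts : Vec (Term F) n) {σ τ} →
              All (λ x → σ x ≡ τ x) (vars* ts) → ts ·* σ ≡ ts ·* τ
    ·*-cong []       σ≗τ = refl
    ·*-cong (t ∷ ts) σ≗τ =
      cong₂ _∷_ (·-cong t (++⁻ˡ (vars t) σ≗τ)) (·*-cong ts (++⁻ʳ (vars t) σ≗τ))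

  fun-injective : ∀ {f} {ts us : Vec (Term F) (arity F f)} → fun f ts ≡ fun f us → ts ≡ us
  fun-injective refl = refl

  mutual
    fixes-vars : ∀ (t : Term F) {σ} → t · σ ≡ t → All (λ x → σ x ≡ var x) (vars t)
    fixes-vars (var x)    tσ≡t = tσ≡t ∷ []
    fixes-vars (fun f ts) tσ≡t = fixes-vars* ts (fun-injective tσ≡t)

    fixes-vars* : ∀ {n} (ts : Vec (Term F) n) {σ} →
                  ts ·* σ ≡ ts → All (λ x → σ x ≡ var x) (vars* ts)
    fixes-vars* []       _ = []
    fixes-vars* (t ∷ ts) ttsσ≡tts with ∷-injective ttsσ≡tts
    ... | tσ≡t , tsσ≡ts = ++⁺ (fixes-vars t tσ≡t) (fixes-vars* ts tsσ≡ts)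

  -- Decidable without comparing function symbols, unlike general equality of terms.
  isVar? : ∀ (t : Term F) x → Dec (t ≡ var x)
  isVar? (var y)    x = map′ (cong var) (λ { refl → refl }) (y ≟ x)
  isVar? (fun f ts) x = no λ ()

  fixes-vars-¬¬ : ∀ (t : Term F) {σ} → ¬ ¬ (t · σ ≡ t) → All (λ x → σ x ≡ var x) (vars t)
  fixes-vars-¬¬ t {σ} ¬¬tσ≡t =
    decidable-stable (All.all? (λ x → isVar? (σ x) x) (vars t))
      (λ ¬fixes → ¬¬tσ≡t (¬fixes ∘ fixes-vars t))

  -- On non-variables the value is junk.
  varOf : Term F → Var
  varOf (var x)    = x
  varOf (fun _ _) = 0

  -- Only a variable can have a variable as an instance, so `σ` sends the variables of `t` to
  -- variables and `τ` inverts it there. This finite injection extends to a bijection, which agrees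
  -- with `σ` on `t` but perhaps not elsewhere.
  invertible⇒renaming : ∀ (t : Term F) σ τ →
    All (λ x → (σ ⊙ τ) x ≡ var x) (vars t) → ∃[ ρ ] t · ⌊ ρ ⌋ ≡ t · σ
  invertible⇒renaming t σ τ στ≗var =
    let ρ , ρ≗f = extendToBijection (varOf ∘ σ) (varOf ∘ τ) (vars t) (All.map (leftInverse _) στ≗var)
    in ρ , ·-cong t (All.zipWith (λ (στx , ρx) → trans (cong var ρx) (isVariable _ στx)) (στ≗var , ρ≗f))
    where
    isVariable : ∀ u {x} → u · τ ≡ var x → var (varOf u) ≡ u
    isVariable (var y) _ = refl

    leftInverse : ∀ x → (σ ⊙ τ) x ≡ var x → varOf (τ (varOf (σ x))) ≡ x
    leftInverse x στx = cong varOf (trans (cong (_· τ) (isVariable (σ x) στx)) στx)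

  -- Sizes of terms under instantiation and contexts

  mutual
    size : Term F → ℕ
    size (var x)    = 1
    size (fun f ts) = suc (size* ts)

    size* : ∀ {n} → Vec (Term F) n → ℕ
    size* []       = 0
    size* (t ∷ ts) = size t + size* ts

  mutual
    size-· : ∀ (t : Term F) σ → size t ≤ size (t · σ)
    size-· (var x)    σ with σ x
    ... | var _   = ≤-refl
    ... | fun _ _ = s≤s z≤n
    size-· (fun f ts) σ = s≤s (size*-·* ts σ)

    size*-·* : ∀ {n} (ts : Vec (Term F) n) σ → size* ts ≤ size* (ts ·* σ)
    size*-·* []       σ = z≤n
    size*-·* (t ∷ ts) σ = +-mono-≤ (size-· t σ) (size*-·* ts σ)

  size*-[]≔ : ∀ {n} (ts : Vec (Term F) n) i t → size t ≤ size* (ts [ i ]≔ t)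
  size*-[]≔ (_ ∷ ts) zero    t = m≤m+n (size t) (size* ts)
  size*-[]≔ (u ∷ ts) (suc i) t = ≤-trans (size*-[]≔ ts i t) (m≤n+m _ (size u))

  size-⟦⟧ : ∀ C (t : Term F) → size t ≤ size (C ⟦ t ⟧)
  size-⟦⟧ □              t = ≤-refl
  size-⟦⟧ (arg f ts i C) t =
    m≤n⇒m≤1+n (≤-trans (size-⟦⟧ C t) (size*-[]≔ ts i _))

  size-⟦·⟧ : ∀ C (t : Term F) σ → size t ≤ size (C ⟦ t · σ ⟧)
  size-⟦·⟧ C t σ = ≤-trans (size-· t σ) (size-⟦⟧ C (t · σ))

  -- A nonempty context adds at least its root symbol, making the size strictly larger than that of
  -- `t`.
  size-⟦·⟧-≤⇒□ : ∀ C (t : Term F) σ → size (C ⟦ t · σ ⟧) ≤ size t → C ≡ □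
  size-⟦·⟧-≤⇒□ □              t σ _  = refl
  size-⟦·⟧-≤⇒□ (arg f ts i C) t σ le =
    ⊥-elim (<-irrefl refl (≤-trans (s≤s (≤-trans (size-⟦·⟧ C t σ) (size*-[]≔ ts i _))) le))

  -- Closure of rewriting under contexts and substitutions

  infixr 9 _∘C_

  _∘C_ : Context F → Context F → Context F
  □            ∘C D = D
  arg f ts i C ∘C D = arg f ts i (C ∘C D)

  ∘C-⟦⟧ : ∀ C D (t : Term F) → C ⟦ D ⟦ t ⟧ ⟧ ≡ (C ∘C D) ⟦ t ⟧
  ∘C-⟦⟧ □              D t = refl
  ∘C-⟦⟧ (arg f ts i C) D t = cong (λ u → fun f (ts [ i ]≔ u)) (∘C-⟦⟧ C D t)

  _·C_ : Context F → Subst F → Context F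
  □            ·C σ = □
  arg f ts i C ·C σ = arg f (ts ·* σ) i (C ·C σ)

  ·*-[]≔ : ∀ {n} (ts : Vec (Term F) n) i t σ → (ts [ i ]≔ t) ·* σ ≡ (ts ·* σ) [ i ]≔ (t · σ)
  ·*-[]≔ (_ ∷ ts) zero    t σ = refl
  ·*-[]≔ (u ∷ ts) (suc i) t σ = cong (u · σ ∷_) (·*-[]≔ ts i t σ)

  ⟦⟧-· : ∀ C (t : Term F) σ → (C ⟦ t ⟧) · σ ≡ (C ·C σ) ⟦ t · σ ⟧
  ⟦⟧-· □              t σ = refl
  ⟦⟧-· (arg f ts i C) t σ = cong (fun f)
    (trans (·*-[]≔ ts i (C ⟦ t ⟧) σ) (cong ((ts ·* σ) [ i ]≔_) (⟦⟧-· C t σ)))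

  module _ {R : ES F} where

    Step-root : ∀ {ℓ r} → R ℓ r → ∀ σ → Step R (ℓ · σ) (r · σ)
    Step-root rule σ = step rule □ σ refl refl

    Step-rule : R ⇒ Step R
    Step-rule {ℓ} {r} rule =
      step rule □ var (sym (·-identity ℓ var λ _ → refl)) (sym (·-identity r var λ _ → refl))

    Step-⟦⟧ : ∀ C {s t} → Step R s t → Step R (C ⟦ s ⟧) (C ⟦ t ⟧)
    Step-⟦⟧ C (step rule D σ refl refl) = step rule (C ∘C D) σ (∘C-⟦⟧ C D _) (∘C-⟦⟧ C D _)

    Step-· : ∀ σ {s t} → Step R s t → Step R (s · σ) (t · σ)
    Step-· σ (step {ℓ} {r} rule C τ refl refl) =
      step rule (C ·C σ) (τ ⊙ σ) (instantiate ℓ) (instantiate r)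
      where
      instantiate : ∀ u → (C ⟦ u · τ ⟧) · σ ≡ (C ·C σ) ⟦ u · (τ ⊙ σ) ⟧
      instantiate u = trans (⟦⟧-· C (u · τ) σ) (cong ((C ·C σ) ⟦_⟧) (·-⊙ u τ σ))

    Step-∪ˡ : ∀ {B : ES F} → Step R ⇒ Step (R ∪ B)
    Step-∪ˡ (step rule C σ s≡ t≡) = step (inj₁ rule) C σ s≡ t≡

    StepMod-normal⇒normal : ∀ {B : ES F} {t} → IsNormalForm (StepMod B R) t → IsNormalForm (Step R) t
    StepMod-normal⇒normal normal (u , s) = normal (u , _ , ε , _ , s , ε)

    normal-Steps : ∀ {s t} → IsNormalForm (Step R) s → Steps R s t → s ≡ t
    normal-Steps normal ε       = refl
    normal-Steps normal (s ◅ _) = ⊥-elim (normal (_ , s))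

    -- The inverse renaming carries any step from the renamed term back to a step from `t`.
    normal-renaming : ∀ ρ {t} → IsNormalForm (Step R) t → IsNormalForm (Step R) (t · ⌊ ρ ⌋)
    normal-renaming ρ {t} normal (u , s) =
      normal (_ , subst (λ v → Step R v (u · ρ⁻¹)) tρρ⁻¹≡t (Step-· ρ⁻¹ s))
      where
      open Inverse (⤖⇒↔ ρ) using (from; strictlyInverseʳ)

      ρ⁻¹ : Subst F
      ρ⁻¹ = var ∘ from

      tρρ⁻¹≡t : t · ⌊ ρ ⌋ · ρ⁻¹ ≡ t
      tρρ⁻¹≡t = trans (·-⊙ t ⌊ ρ ⌋ ρ⁻¹) (·-identity t _ (λ x → cong var (strictlyInverseʳ x)))

  -- Normal forms and reducibility under a compatible order

  module _ {B : ES F} {_>_ : Rel (Term F) _} (order : IsCompatibleReductionOrder B _>_) where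

    open IsCompatibleReductionOrder order
    open IsStrictPartialOrder isStrictPartialOrder using () renaming (irrefl to >-irrefl; trans to >-trans)

    Step⇒> : ∀ {R : ES F} → R ⇒ _>_ → Step R ⇒ _>_
    Step⇒> R⇒> (step rule C σ refl refl) = context-closed C (subst-closed σ (R⇒> rule))

    >-Steps : ∀ {R : ES F} → R ⇒ _>_ → ∀ {s t u} → s > t → Steps R t u → s > u
    >-Steps R⇒> s>t ε        = s>t
    >-Steps R⇒> s>t (t→ ◅ →u) = >-Steps R⇒> (>-trans s>t (Step⇒> R⇒> t→)) →u

    -- Compatibility would absorb the conversion and yield `s > s`.
    >⇒¬Conv : ∀ {s t} → s > t → ¬ Conv B t s
    >⇒¬Conv s>t t∼s = >-irrefl refl (compatible (_ , ε , _ , s>t , t∼s))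

    module _ {R S : ES F} (R⇒> : R ⇒ _>_) (S⇒> : S ⇒ _>_) where

      -- Joining the ends of an `S`-step from `t` to `t′` leaves the `R`-normal `t` in place, so
      -- `t′` reduces to some `v` with `t` and `v` equal modulo `B`. But `t > t′` gives `t > v`.
      normal⇒normal : ChurchRosserMod B R → Conv (S ∪ B) ⇒ Conv (R ∪ B) →
        ∀ {t} → IsNormalForm (Step R) t → IsNormalForm (Step S) t
      normal⇒normal CR S⇒R normal (t′ , t→t′) with CR (S⇒R (return (Step-∪ˡ t→t′)))
      ... | _ , t→*u , v , u∼v , t′→*v with normal-Steps normal t→*u
      ...   | refl = >⇒¬Conv (>-Steps R⇒> (Step⇒> S⇒> t→t′) t′→*v) (symmetric (Step B) u∼v)

      -- In the joining of `ℓ` and `r` the normal `r` stays put. If `ℓ` stayed put too, they would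
      -- be equal modulo `B` despite `ℓ > r`; hence the joining sequence itself supplies a step from
      -- `ℓ`.
      lhs-reducible : ChurchRosserMod B S → Conv (R ∪ B) ⇒ Conv (S ∪ B) →
        ∀ {ℓ r} → R ℓ r → IsNormalForm (Step S) r → ∃[ t ] Step S ℓ t
      lhs-reducible CR R⇒S rule normal with CR (R⇒S (return (Step-∪ˡ (Step-rule rule))))
      ... | _ , ℓ→ ◅ _ , _                = _ , ℓ→
      ... | _ , ε , v , ℓ∼v , r→*v with normal-Steps normal r→*v
      ...   | refl = ⊥-elim (>⇒¬Conv (R⇒> rule) (symmetric (Step B) ℓ∼v))

  -- Left-hand sides as variants of each other

  mutually-reducible⇒lhs-variant : ∀ {R S : ES F} → LeftReduced R →
    ∀ {ℓ r} → R ℓ r → ∃[ t ] Step S ℓ t → (∀ {ℓ′ r′} → S ℓ′ r′ → ∃[ t ] Step R ℓ′ t) →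
    ∃[ ℓ′ ] ∃[ r′ ] (S ℓ′ r′ × ∃[ ρ ] ℓ · ⌊ ρ ⌋ ≡ ℓ′)
  mutually-reducible⇒lhs-variant {R} {S} leftReduced {ℓ} {r} rule (_ , step {ℓ′} {r′} rule′ C σ ℓ≡ _) reducible
    with reducible rule′
  ... | _ , step {ℓ″} {r″} rule″ C′ τ ℓ′≡ _ = ℓ′ , r′ , rule′ , renaming′
    where
    -- A rule with a different left-hand side survives the removal of `ℓ → r`, and its step from
    -- `ℓ′`, instantiated by `σ` and placed in `C`, would reduce `ℓ`.
    ¬¬same : ¬ ¬ (ℓ″ ≡ ℓ)
    ¬¬same ℓ″≢ℓ = leftReduced rule (_ , subst (λ t → Step _ t _) (sym ℓ≡) (Step-⟦⟧ C (Step-· σ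
      (step {R = R ∖⟨ ℓ , r ⟩} (rule″ , ℓ″≢ℓ ∘ cong proj₁) C′ τ ℓ′≡ refl))))

    size≤ : size ℓ ≤ size ℓ″
    size≤ = decidable-stable (_ ≤? _) (λ ¬≤ → ¬¬same (λ { refl → ¬≤ ≤-refl }))

    -- The sizes of `ℓ`, `ℓ″` and `ℓ′` form a cycle of inequalities; each context is bounded by
    -- going round it.
    C≡□ : C ≡ □
    C≡□ = size-⟦·⟧-≤⇒□ C ℓ′ σ (begin
      size (C ⟦ ℓ′ · σ ⟧)   ≡⟨ cong size ℓ≡ ⟨
      size ℓ                ≤⟨ size≤ ⟩
      size ℓ″               ≤⟨ size-⟦·⟧ C′ ℓ″ τ ⟩
      size (C′ ⟦ ℓ″ · τ ⟧)  ≡⟨ cong size ℓ′≡ ⟨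
      size ℓ′               ∎)
      where open ≤-Reasoning

    C′≡□ : C′ ≡ □
    C′≡□ = size-⟦·⟧-≤⇒□ C′ ℓ″ τ (begin
      size (C′ ⟦ ℓ″ · τ ⟧)  ≡⟨ cong size ℓ′≡ ⟨
      size ℓ′               ≤⟨ size-⟦·⟧ C ℓ′ σ ⟩
      size (C ⟦ ℓ′ · σ ⟧)   ≡⟨ cong size ℓ≡ ⟨
      size ℓ                ≤⟨ size≤ ⟩
      size ℓ″               ∎)
      where open ≤-Reasoning

    ℓ′≡ℓ″τ : ℓ′ ≡ ℓ″ · τ
    ℓ′≡ℓ″τ = trans ℓ′≡ (cong (_⟦ ℓ″ · τ ⟧) C′≡□)

    ℓ≡ℓ″τσ : ℓ ≡ ℓ″ · (τ ⊙ σ)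
    ℓ≡ℓ″τσ = begin
      ℓ               ≡⟨ ℓ≡ ⟩
      C ⟦ ℓ′ · σ ⟧    ≡⟨ cong (_⟦ ℓ′ · σ ⟧) C≡□ ⟩
      ℓ′ · σ          ≡⟨ cong (_· σ) ℓ′≡ℓ″τ ⟩
      ℓ″ · τ · σ      ≡⟨ ·-⊙ ℓ″ τ σ ⟩
      ℓ″ · (τ ⊙ σ)    ∎
      where open ≡-Reasoning

    τσ≗var : All (λ x → (τ ⊙ σ) x ≡ var x) (vars ℓ″)
    τσ≗var = fixes-vars-¬¬ ℓ″ (λ ≢ → ¬¬same (λ ℓ″≡ℓ → ≢ (trans (sym ℓ≡ℓ″τσ) (sym ℓ″≡ℓ))))

    -- The double negation is now gone: `τ ⊙ σ` is known to act as the identity on `ℓ″`.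
    ℓ≡ℓ″ : ℓ ≡ ℓ″
    ℓ≡ℓ″ = trans ℓ≡ℓ″τσ (trans (·-cong ℓ″ τσ≗var) (·-identity ℓ″ var λ _ → refl))

    -- The renaming comes from `τ`, which leads from `ℓ″` to `ℓ′`; `σ` is its inverse.
    renaming′ : ∃[ ρ ] ℓ · ⌊ ρ ⌋ ≡ ℓ′
    renaming′ with invertible⇒renaming ℓ″ τ σ τσ≗var
    ... | ρ , ℓ″ρ≡ℓ″τ = ρ , trans (cong (_· ⌊ ρ ⌋) ℓ≡ℓ″) (trans ℓ″ρ≡ℓ″τ (sym ℓ′≡ℓ″τ))

  -- Comparing the right-hand sides

  everyRuleHasVariant : ∀ {B R S : ES F} {_>_} → IsCompatibleReductionOrder B _>_ →
    R ⇒ _>_ → S ⇒ _>_ → EquivalentMod B R S → CanonicalMod B R → CanonicalMod B S →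
    EveryRuleHasVariantIn B R S
  everyRuleHasVariant {B} {R} {S} order R⇒> S⇒> (R⇒S , S⇒R) canR canS {ℓ} {r} rule =
    conclude (mutually-reducible⇒lhs-variant R.leftReduced rule (R-reducible rule) S-reducible)
    where
    module R = CanonicalMod canR
    module S = CanonicalMod canS
    open CompleteMod R.complete renaming (churchRosser to CR-R) using ()
    open CompleteMod S.complete renaming (churchRosser to CR-S) using ()

    R-reducible : ∀ {ℓ r} → R ℓ r → ∃[ t ] Step S ℓ t
    R-reducible rule = lhs-reducible order R⇒> S⇒> CR-S R⇒S rule
      (normal⇒normal order R⇒> S⇒> CR-R S⇒R (StepMod-normal⇒normal (R.rightReduced rule)))

    S-reducible : ∀ {ℓ r} → S ℓ r → ∃[ t ] Step R ℓ t
    S-reducible rule = lhs-reducible order S⇒> R⇒> CR-R S⇒R rule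
      (normal⇒normal order S⇒> R⇒> CR-S R⇒S (StepMod-normal⇒normal (S.rightReduced rule)))

    conclude : ∃[ ℓ′ ] ∃[ r′ ] (S ℓ′ r′ × ∃[ ρ ] ℓ · ⌊ ρ ⌋ ≡ ℓ′) →
               ∃[ ℓ′ ] ∃[ r′ ] (S ℓ′ r′ × RightEquivalentVariants B ℓ r ℓ′ r′)
    conclude (ℓ′ , r′ , rule′ , ρ , refl) = ℓ′ , r′ , rule′ , ρ , refl , rρ∼r′
      where
      rρ↔r′ : Conv (R ∪ B) (r · ⌊ ρ ⌋) r′
      -- Both steps start at the same term, since `ℓ′` is the renamed `ℓ`.
      rρ↔r′ = symmetric _ (return (Step-∪ˡ (Step-root rule ⌊ ρ ⌋)))
           ◅◅ S⇒R (return (Step-∪ˡ (Step-rule rule′)))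

      rρ∼r′ : Conv B (r · ⌊ ρ ⌋) r′
      -- Both ends are `R`-normal, `r′` by transfer from `S`, so only the `B`-conversion in the
      -- middle of the joining remains.
      rρ∼r′ with CR-R rρ↔r′
      ... | u , rρ→*u , v , u∼v , r′→*v = subst₂ (Conv B)
        (sym (normal-Steps (normal-renaming ρ (StepMod-normal⇒normal (R.rightReduced rule))) rρ→*u))
        (sym (normal-Steps (normal⇒normal order S⇒> R⇒> CR-S R⇒S
          (StepMod-normal⇒normal (S.rightReduced rule′))) r′→*v))
        u∼v

theorem6p18 : (F : Signature) (B : ES F) → SameVars B →
    (R S : ES F) → IsTRS R → IsTRS S →
    EquivalentMod B R S → CanonicalMod B R → CanonicalMod B S →
    (∃[ _>_ ] (IsCompatibleReductionOrder B _>_ × ((R ∪ S) ⇒ _>_))) →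
    EveryRuleHasVariantIn B R S × EveryRuleHasVariantIn B S R
theorem6p18 F B _ R S _ _ (R⇒S , S⇒R) canR canS (_ , order , oriented) =
    everyRuleHasVariant order R⇒> S⇒> ((λ p → R⇒S p) , (λ p → S⇒R p)) canR canS
  , everyRuleHasVariant order S⇒> R⇒> ((λ p → S⇒R p) , (λ p → R⇒S p)) canS canR
  where
  R⇒> : R ⇒ _
  R⇒> rule = oriented (inj₁ rule)

  S⇒> : S ⇒ _
  S⇒> rule = oriented (inj₂ rule)
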